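{- Let $a>b$ be relatively prime positive integers and let $\omega,\omega'\in\mathcal{D}(a,b)$. Suppose there are positive integers $k,l$ such that some cyclic shift of the period of $g(\omega')$ is of type $(k,l)$. Suppose further that for all positive integers $i,j$ such that some cyclic shift of the period of $g(\omega)$ is of type $(i,j)$, we have either ($i<k$ and $j<l$) or ($i<l$ and $j<k$). Then $L(\omega)<L(\omega')$.
   Context: A lattice path from $(0,0)$ to $(a,b)$ is a word in the letters $R$ (unit step right) and $U$ (unit step up) with $a$ letters $R$ and $b$ letters $U$; $\mathcal{D}(a,b)$ is the set of such paths lying (weakly) below the line $y=\frac bax$. For a word $W=w_1\cdots w_n$, $f(W)=[a_0,\ldots,a_t]$ is the finite continued fraction whose entry sequence is obtained by scanning $i=1,\ldots,n-1$ and appending $1,1$ if $w_i=w_{i+1}$ and $2$ if $w_i\ne w_{i+1}$; $g(\omega)=[\overline{2,a_0,\ldots,a_t}]$ is the purely periodic infinite continued fraction with period $(2,a_0,\ldots,a_t)$. For positive integers $i,j$, a cyclic shift of this period (a finite sequence of 1s and 2s) is said to be of type $(i,j)$ if it has the form $(2,\underbrace{1,\ldots,1}_{2(i-1)},Y,\underbrace{1,\ldots,1}_{2(j-1)})$, where $Y$ is a finite sequence of 1s and 2s whose first and last entries are $2$ (possibly $Y=(2)$); i.e. the shift $[\overline{2,1,\ldots,1,2,\ldots,2,1,\ldots,1}]$ of $g(\omega)$ begins with $2$, then $2(i-1)$ ones, then $2$, arbitrary terms, $2$, and ends with $2(j-1)$ ones. For irrational $\alpha$, $L(\alpha)=\sup\{L: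 |\frac pq-\alpha|<\frac{1}{Lq^2}\text{ for infinitely many reduced }\frac pq\}$ and $L(\omega):=L(g(\omega))$. -}

module Defs where

open import Data.Nat using (ℕ; zero; suc; _+_; _*_; _∸_; _≤_; _<_; _%_; pred)
open import Data.Nat.Coprimality using (Coprime)
open import Data.Integer using (ℤ; +_; ∣_∣)
open import Data.Rational.Unnormalised using (ℚᵘ; mkℚᵘ; _-_)
  renaming (_+_ to _+ᵠ_; _≤_ to _≤ᵠ_; _<_ to _<ᵠ_)
open import Data.List using (List; []; _∷_; _++_; length; take; drop; replicate)
open import Data.Product using (Σ; ∃; _×_; _,_)
open import Data.Sum using (_⊎_)
open import Relation.Nullary using (¬_)
open import Relation.Binary.PropositionalEquality using (_≡_)

data Step : Set where
  R U : Step

Word : Set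
Word = List Step

countR : Word → ℕ
countR []      = 0
countR (R ∷ w) = suc (countR w)
countR (U ∷ w) = countR w

countU : Word → ℕ
countU []      = 0
countU (R ∷ w) = countU w
countU (U ∷ w) = suc (countU w)

-- ω ∈ 𝒟(a,b): a letters R, b letters U, and every prefix (r R's, u U's)
-- lies weakly below y = (b/a) x, i.e. a·u ≤ b·r.
InD : ℕ → ℕ → Word → Set
InD a b w = countR w ≡ a × countU w ≡ b
          × (∀ k → a * countU (take k w) ≤ b * countR (take k w))

sameStep : Step → Step → List ℕ
sameStep R R = 1 ∷ 1 ∷ []
sameStep U U = 1 ∷ 1 ∷ []
sameStep R U = 2 ∷ []
sameStep U R = 2 ∷ []

f : Word → List ℕ
f (x ∷ y ∷ w) = sameStep x y ++ f (y ∷ w)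
f _           = []

period : Word → List ℕ
period w = 2 ∷ f w

rotate : ℕ → List ℕ → List ℕ
rotate k xs = drop k xs ++ take k xs

FirstLast2 : List ℕ → Set
FirstLast2 Y = Y ≡ 2 ∷ [] ⊎ Σ (List ℕ) (λ Z → Y ≡ 2 ∷ (Z ++ 2 ∷ []))

HasType : ℕ → ℕ → List ℕ → Set
HasType i j P = Σ ℕ λ k → k < length P × Σ (List ℕ) λ Y → FirstLast2 Y ×
  rotate k P ≡ 2 ∷ (replicate (2 * (i ∸ 1)) 1 ++ Y ++ replicate (2 * (j ∸ 1)) 1)

-- The continued fraction g(ω) = [2; a₀, …, a_t, 2, a₀, …] as a real
-- number, encoded by its Dedekind cut via convergents.

nthOr0 : List ℕ → ℕ → ℕ
nthOr0 []       _       = 0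
nthOr0 (x ∷ xs) zero    = x
nthOr0 (x ∷ xs) (suc n) = nthOr0 xs n

gseq : Word → ℕ → ℕ
gseq w n = nthOr0 (2 ∷ f w) (n % suc (length (f w)))

-- (p_n , q_n , p_{n-1} , q_{n-1}) for the continued fraction [c 0; c 1, …]
pq : (ℕ → ℕ) → ℕ → ℕ × ℕ × ℕ × ℕ
pq c zero = c 0 , 1 , 1 , 0
pq c (suc n) with pq c n
... | p , q , p' , q' = c (suc n) * p + p' , c (suc n) * q + q' , p , q

-- n-th convergent p_n / q_n   (q_n ≥ 1 always)
conv : (ℕ → ℕ) → ℕ → ℚᵘ
conv c n with pq c n
... | p , q , _ = mkℚᵘ (+ p) (pred q)

-- x < [c 0; c 1, …]   (even convergents increase to the value)
CFAbove : (ℕ → ℕ) → ℚᵘ → Set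
CFAbove c x = ∃ λ n → x ≤ᵠ conv c (2 * n)

-- [c 0; c 1, …] < y   (odd convergents decrease to the value)
CFBelow : (ℕ → ℕ) → ℚᵘ → Set
CFBelow c y = ∃ λ n → conv c (suc (2 * n)) ≤ᵠ y

-- Lagrange value.
-- A positive rational L is written L = (m+1)/(d+1) = mkℚᵘ (+ suc m) d.
-- For q = suc q', 1/(L q²) = (d+1)/((m+1) q²).

invLq² : ℕ → ℕ → ℕ → ℚᵘ
invLq² m d q = mkℚᵘ (+ suc d) (pred (suc m * q * q))

-- |p/q − α| < 1/(L q²) for α = [c 0; c 1, …]
CloseApprox : (ℕ → ℕ) → ℕ → ℕ → ℤ → ℕ → Set
CloseApprox c m d p q' =
  CFAbove c (mkℚᵘ p q' - invLq² m d (suc q')) ×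
  CFBelow c (mkℚᵘ p q' +ᵠ invLq² m d (suc q'))

-- |p/q − α| < 1/(L q²) for infinitely many reduced p/q
-- (for fixed q only finitely many p qualify, so: for arbitrarily large q)
Admissible : (ℕ → ℕ) → ℕ → ℕ → Set
Admissible c m d = ∀ N → Σ ℤ λ p → Σ ℕ λ q' →
  N < suc q' × Coprime ∣ p ∣ (suc q') × CloseApprox c m d p q'

-- L(ω) < L(ω'), where L(α) = sup { L > 0 : Admissible α L }.
-- Since the admissible set is downward closed, sup S < sup S' iff there are
-- positive rationals r < r' with r ∉ S and r' ∈ S'.
LagrangeLt : Word → Word → Set
LagrangeLt w w' = Σ ℕ λ m → Σ ℕ λ d → Σ ℕ λ m' → Σ ℕ λ d' →
  mkℚᵘ (+ suc m) d <ᵠ mkℚᵘ (+ suc m') d' ×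
  ¬ Admissible (gseq w) m d × Admissible (gseq w') m' d'

{-# OPTIONS --safe #-}

-- At the n-th convergent of a continued fraction α, 1 / (q |q α − p|) is the sum of the tail
-- [c (n+1); c (n+2), …] and the reversed initial segment [0; c n, …, c 1].  If c (n+1) = 2 is
-- surrounded by runs of 2i and 2j ones, this is 2 + [0; 1^{2i}, 2, …] + [0; 1^{2j}, 2, …], and
-- [0; 1^{2i}, 2, …] increases with i whatever follows the 2.  With K = k − 1 and L = l − 1, the
-- value r = 2 + [0; 1^{2K}] + [0; 1^{2L}] therefore bounds all these sums for ω, whereas those at
-- the given shift for ω' are at least r' = 2 + [0; 1^{2K}, 3] + [0; 1^{2L}, 3] > r.  As ω has at
-- least one type, K and L are positive, so r ≥ 3, which disposes of the entries 1 and of the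
-- fractions that are not convergents.  The real number α is always replaced by a convergent
-- p_N / q_N of high order, which turns every estimate into one between natural numbers.
module Submission where

open import Defs
open import Data.Nat
open import Data.Nat.Properties
open import Data.Nat.Coprimality using (Coprime)
open import Data.Nat.Divisibility using (_∣_; divides; ∣m+n∣m⇒∣n; ∣n⇒∣m*n; ∣m⇒∣m*n; ∣1⇒≡1)
open import Data.Nat.DivMod
open import Data.Nat.Tactic.RingSolver using (solve-∀)
open import Data.Integer as ℤ using (ℤ; +_; -[1+_])
import Data.Integer.Properties as ℤ
import Data.Integer.Tactic.RingSolver as ℤ-Solver
open import Data.Rational.Unnormalised using (mkℚᵘ; *≤*; *<*; _-_)
  renaming (_+_ to _+ᵠ_; _≤_ to _≤ᵠ_)
import Data.Rational.Unnormalised.Properties as ℚᵘ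
open import Data.List using (List; []; _∷_; _++_; length; take; drop; replicate)
open import Data.List.Properties using (take++drop≡id; ++-assoc; length-++; length-take; length-drop)
open import Data.List.Membership.Propositional using (_∈_)
open import Data.List.Membership.Propositional.Properties using (∈-++⁺ˡ; ∈-++⁺ʳ)
open import Data.List.Relation.Unary.Any using (here; there)
open import Data.Product
open import Data.Sum using (_⊎_; inj₁; inj₂; [_,_]′)
open import Data.Unit using (⊤; tt)
open import Data.Empty using (⊥; ⊥-elim)
open import Function using (_∘_; _$_)
open import Relation.Nullary using (¬_; yes; no)
open import Relation.Binary.PropositionalEquality

open ≤-Reasoning

-- Approximation inequalities with denominators cleared

-- P/Q lies above p/q − D/(M q²), respectively below p/q + D/(M q²).
record Above (M D p q P Q : ℕ) : Set where
  constructor above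
  field bound : M * q * p * Q ≤ M * q * q * P + D * Q

record Below (M D p q P Q : ℕ) : Set where
  constructor below
  field bound : M * q * q * P ≤ M * q * p * Q + D * Q

pos-*₃ : ∀ a b c → + (a * b * c) ≡ + a ℤ.* + b ℤ.* + c
pos-*₃ a b c = trans (ℤ.pos-* (a * b) c) (cong (ℤ._* + c) (ℤ.pos-* a b))

module _ (p X D q Q P Y : ℕ) where

  private
    shift⁻ : ∀ p X D q Q → (p ℤ.* X ℤ.+ (ℤ.- D) ℤ.* q) ℤ.* Q ℤ.+ D ℤ.* q ℤ.* Q ≡ p ℤ.* X ℤ.* Q
    shift⁻ = ℤ-Solver.solve-∀

    difference : ℤ
    difference = (+ p ℤ.* + X ℤ.+ (ℤ.- + D) ℤ.* + q) ℤ.* + Q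

    difference-eq : difference ℤ.+ + (D * q * Q) ≡ + (p * X * Q)
    difference-eq = trans (cong (λ z → difference ℤ.+ z) (pos-*₃ D q Q))
      (trans (shift⁻ (+ p) (+ X) (+ D) (+ q) (+ Q)) (sym (pos-*₃ p X Q)))

    bound-eq : + P ℤ.* + Y ℤ.+ + (D * q * Q) ≡ + (P * Y + D * q * Q)
    bound-eq = trans (cong (ℤ._+ + (D * q * Q)) (sym (ℤ.pos-* P Y))) (sym (ℤ.pos-+ (P * Y) _))

    cancelʳ : ∀ x y z → x ℤ.+ z ℤ.≤ y ℤ.+ z → x ℤ.≤ y
    cancelʳ x y z h = subst₂ ℤ._≤_ (e x z) (e y z) (ℤ.+-monoˡ-≤ (ℤ.- z) h)
      where e : ∀ x z → x ℤ.+ z ℤ.+ (ℤ.- z) ≡ x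
            e = ℤ-Solver.solve-∀

    plus-eq : (+ p ℤ.* + X ℤ.+ + D ℤ.* + q) ℤ.* + Q ≡ + ((p * X + D * q) * Q)
    plus-eq = sym (trans (ℤ.pos-* (p * X + D * q) Q) (cong (ℤ._* + Q)
      (trans (ℤ.pos-+ (p * X) (D * q)) (cong₂ ℤ._+_ (ℤ.pos-* p X) (ℤ.pos-* D q)))))

  -- The left side is what `_-_` and `_≤ᵠ_` unfold to, with X the denominator of `invLq²` and Y = q
  -- X in the applications. Adding D q Q to both sides removes the negative term, and the inequality
  -- descends from ℤ to ℕ.
  minus⇒ : (+ p ℤ.* + X ℤ.+ (ℤ.- + D) ℤ.* + q) ℤ.* + Q ℤ.≤ + P ℤ.* + Y →
           p * X * Q ≤ P * Y + D * q * Q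
  minus⇒ h = ℤ.drop‿+≤+ (subst₂ ℤ._≤_ difference-eq bound-eq (ℤ.+-monoˡ-≤ (+ (D * q * Q)) h))

  minus⇐ : p * X * Q ≤ P * Y + D * q * Q →
           (+ p ℤ.* + X ℤ.+ (ℤ.- + D) ℤ.* + q) ℤ.* + Q ℤ.≤ + P ℤ.* + Y
  minus⇐ h = cancelʳ _ _ (+ (D * q * Q)) (subst₂ ℤ._≤_ (sym difference-eq) (sym bound-eq) (ℤ.+≤+ h))

  plus⇒ : + P ℤ.* + Y ℤ.≤ (+ p ℤ.* + X ℤ.+ + D ℤ.* + q) ℤ.* + Q → P * Y ≤ (p * X + D * q) * Q
  plus⇒ h = ℤ.drop‿+≤+ (subst₂ ℤ._≤_ (sym (ℤ.pos-* P Y)) plus-eq h)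

  plus⇐ : P * Y ≤ (p * X + D * q) * Q → + P ℤ.* + Y ℤ.≤ (+ p ℤ.* + X ℤ.+ + D ℤ.* + q) ℤ.* + Q
  plus⇐ h = subst₂ ℤ._≤_ (ℤ.pos-* P Y) (sym plus-eq) (ℤ.+≤+ h)

module _ (m d p q' P Q' : ℕ) where

  private
    M D q Q : ℕ
    M = suc m
    D = suc d
    q = suc q'
    Q = suc Q'

    above-l : ∀ M q p Q → p * (M * q * q) * Q ≡ q * (M * q * p * Q)
    above-l = solve-∀
    above-r : ∀ M D q P Q → P * (q * (M * q * q)) + D * q * Q ≡ q * (M * q * q * P + D * Q)
    above-r = solve-∀
    below-l : ∀ M q P → P * (q * (M * q * q)) ≡ q * (M * q * q * P)
    below-l = solve-∀
    below-r : ∀ M D q p Q → (p * (M * q * q) + D * q) * Q ≡ q * (M * q * p * Q + D * Q)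
    below-r = solve-∀

  above⇒ : mkℚᵘ (+ p) q' - invLq² m d q ≤ᵠ mkℚᵘ (+ P) Q' → Above M D p q P Q
  above⇒ (*≤* h) = above $ *-cancelˡ-≤ q (subst₂ _≤_ (above-l M q p Q) (above-r M D q P Q)
    (minus⇒ p (M * q * q) D q Q P (q * (M * q * q)) h))

  above⇐ : Above M D p q P Q → mkℚᵘ (+ p) q' - invLq² m d q ≤ᵠ mkℚᵘ (+ P) Q'
  above⇐ (above h) = *≤* (minus⇐ p (M * q * q) D q Q P (q * (M * q * q))
    (subst₂ _≤_ (sym (above-l M q p Q)) (sym (above-r M D q P Q)) (*-monoʳ-≤ q h)))

  below⇒ : mkℚᵘ (+ P) Q' ≤ᵠ mkℚᵘ (+ p) q' +ᵠ invLq² m d q → Below M D p q P Q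
  below⇒ (*≤* h) = below $ *-cancelˡ-≤ q (subst₂ _≤_ (below-l M q P) (below-r M D q p Q)
    (plus⇒ p (M * q * q) D q Q P (q * (M * q * q)) h))

  below⇐ : Below M D p q P Q → mkℚᵘ (+ P) Q' ≤ᵠ mkℚᵘ (+ p) q' +ᵠ invLq² m d q
  below⇐ (below h) = *≤* (plus⇐ p (M * q * q) D q Q P (q * (M * q * q))
    (subst₂ _≤_ (sym (below-l M q P)) (sym (below-r M D q p Q)) (*-monoʳ-≤ q h)))

-- Raising a negative numerator to 0 only weakens the upper bound. This half suffices later, since 0
-- is still less than `c 0`.
below-neg⇒ : ∀ m d p q' P Q' → mkℚᵘ (+ P) Q' ≤ᵠ mkℚᵘ -[1+ p ] q' +ᵠ invLq² m d (suc q') →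
             Below (suc m) (suc d) 0 (suc q') P (suc Q')
below-neg⇒ m d p q' P Q' h = below⇒ m d 0 q' P Q'
  (ℚᵘ.≤-trans h (ℚᵘ.+-monoˡ-≤ (invLq² m d (suc q')) {mkℚᵘ -[1+ p ] q'} {mkℚᵘ (+ 0) q'} (*≤* ℤ.-≤+)))

-- Carries the bound from the convergent that witnesses the cut to convergents of higher order.
above-mono : ∀ {M D p q P Q P' Q'} → 1 ≤ Q → P * Q' ≤ Q * P' →
             Above M D p q P Q → Above M D p q P' Q'
above-mono {M} {D} {p} {q} {P} {Q@(suc _)} {P'} {Q'} _ le (above h) = above $ *-cancelˡ-≤ Q (begin
  Q * (M * q * p * Q')                ≡⟨ e₁ Q (M * q * p) Q' ⟩
  (M * q * p * Q) * Q'                ≤⟨ *-monoˡ-≤ Q' h ⟩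
  (M * q * q * P + D * Q) * Q'        ≡⟨ e₂ (M * q * q) P D Q Q' ⟩
  M * q * q * (P * Q') + D * Q * Q'   ≤⟨ +-monoˡ-≤ (D * Q * Q') (*-monoʳ-≤ (M * q * q) le) ⟩
  M * q * q * (Q * P') + D * Q * Q'   ≡⟨ e₃ (M * q * q) P' D Q Q' ⟩
  Q * (M * q * q * P' + D * Q')       ∎)
  where
  e₁ : ∀ Q x Q' → Q * (x * Q') ≡ x * Q * Q'
  e₁ = solve-∀
  e₂ : ∀ x P D Q Q' → (x * P + D * Q) * Q' ≡ x * (P * Q') + D * Q * Q'
  e₂ = solve-∀
  e₃ : ∀ x P' D Q Q' → x * (Q * P') + D * Q * Q' ≡ Q * (x * P' + D * Q')
  e₃ = solve-∀

below-mono : ∀ {M D p q P Q P' Q'} → 1 ≤ Q → Q * P' ≤ P * Q' →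
             Below M D p q P Q → Below M D p q P' Q'
below-mono {M} {D} {p} {q} {P} {Q@(suc _)} {P'} {Q'} _ le (below h) = below $ *-cancelˡ-≤ Q (begin
  Q * (M * q * q * P')                ≡⟨ e₁ Q (M * q * q) P' ⟩
  M * q * q * (Q * P')                ≤⟨ *-monoʳ-≤ (M * q * q) le ⟩
  M * q * q * (P * Q')                ≡⟨ e₂ (M * q * q) P Q' ⟩
  M * q * q * P * Q'                  ≤⟨ *-monoˡ-≤ Q' h ⟩
  (M * q * p * Q + D * Q) * Q'        ≡⟨ e₃ (M * q * p) D Q Q' ⟩
  Q * (M * q * p * Q' + D * Q')       ∎)
  where
  e₁ : ∀ Q x P' → Q * (x * P') ≡ x * (Q * P')
  e₁ = solve-∀
  e₂ : ∀ x P Q' → x * (P * Q') ≡ x * P * Q'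
  e₂ = solve-∀
  e₃ : ∀ x D Q Q' → (x * Q + D * Q) * Q' ≡ Q * (x * Q' + D * Q')
  e₃ = solve-∀

-- Comparison of the fractions [0; 1^{2K}, ...]

-- The Möbius map x ↦ (1 + x) / (2 + x) prepends two partial quotients 1 to [0; …].
frac : ℕ × ℕ → ℕ → ℕ × ℕ
frac x zero    = x
frac x (suc K) = proj₁ (frac x K) + proj₂ (frac x K) , proj₁ (frac x K) + 2 * proj₂ (frac x K)

num den : ℕ × ℕ → ℕ → ℕ
num x K = proj₁ (frac x K)
den x K = proj₂ (frac x K)

-- The Möbius map has determinant 1, so the two cross products differ only in d b against n a, and
-- the map is increasing. The factors `1 *` are partial quotients, kept to match the recursions of
-- `A` and `q`.
mobius-expandˡ : ∀ n d a b → (n + 2 * d) * (1 * a + b) ≡ (n * (a + b) + 2 * d * a + d * b) + d * b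
mobius-expandˡ = solve-∀

mobius-expandʳ : ∀ n d a b → (n + d) * (1 * (1 * a + b) + a) ≡ (n * (a + b) + 2 * d * a + d * b) + n * a
mobius-expandʳ = solve-∀

mobius-< : ∀ n d a b → d * b < n * a → (n + 2 * d) * (1 * a + b) < (n + d) * (1 * (1 * a + b) + a)
mobius-< n d a b h = subst₂ _<_ (sym (mobius-expandˡ n d a b)) (sym (mobius-expandʳ n d a b))
  (+-monoʳ-< (n * (a + b) + 2 * d * a + d * b) h)

mobius-≤ : ∀ n d a b → d * b ≤ n * a → (n + 2 * d) * (1 * a + b) ≤ (n + d) * (1 * (1 * a + b) + a)
mobius-≤ n d a b h = subst₂ _≤_ (sym (mobius-expandˡ n d a b)) (sym (mobius-expandʳ n d a b))
  (+-monoʳ-≤ (n * (a + b) + 2 * d * a + d * b) h)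

mobius-≥ : ∀ n d a b → n * a ≤ d * b → (n + d) * (1 * (1 * a + b) + a) ≤ (n + 2 * d) * (1 * a + b)
mobius-≥ n d a b h = subst₂ _≤_ (sym (mobius-expandʳ n d a b)) (sym (mobius-expandˡ n d a b))
  (+-monoʳ-≤ (n * (a + b) + 2 * d * a + d * b) h)

-- For i < K, frac upper K = [0; 1^{2K}] exceeds every [0; 1^{2i}, 2, …], while
-- frac lower K = [0; 1^{2K}, 3] is at most every [0; 1^{2K}, 2, …].
upper lower : ℕ × ℕ
upper = 0 , 1
lower = 1 , 3

-- Starts from 0 < 1/3 and is preserved by the increasing Möbius map. This strict gap is what
-- separates the two Lagrange values.
frac-< : ∀ K → num upper K * den lower K < num lower K * den upper K
frac-< zero    = s≤s z≤n
frac-< (suc K) = subst₂ _<_ (sym (e₁ n d n' d')) (sym (e₂ n d n' d')) (+-monoʳ-< _ (frac-< K))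
  where
  n = num upper K
  d = den upper K
  n' = num lower K
  d' = den lower K
  e₁ : ∀ n d n' d' → (n + d) * (n' + 2 * d') ≡ (n * n' + n * d' + d * n' + 2 * d * d') + n * d'
  e₁ = solve-∀
  e₂ : ∀ n d n' d' → (n' + d') * (n + 2 * d) ≡ (n * n' + n * d' + d * n' + 2 * d * d') + n' * d
  e₂ = solve-∀

den≥1 : ∀ x K → 1 ≤ den x 0 → 1 ≤ den x K
den≥1 x zero    h = h
den≥1 x (suc K) h = ≤-trans (≤-trans (den≥1 x K h) (m≤m+n _ _)) (m≤n+m _ (num x K))

-- (1 + x) / (2 + x) ≥ 1/2 for x ≥ 0. Both the bound r ≥ 3 and the comparison with [0; 2, ...] rest
-- on this.
half≤upper : ∀ K → den upper (suc K) ≤ 2 * num upper (suc K)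
half≤upper K = subst (den upper (suc K) ≤_) (e (num upper K) (den upper K)) (m≤m+n _ _)
  where e : ∀ n d → n + 2 * d + n ≡ 2 * (n + d)
        e = solve-∀

-- Ones come in pairs so that each recursive step is one application of the Möbius map.
ones : ℕ → List ℕ
ones zero    = []
ones (suc i) = 1 ∷ 1 ∷ ones i

replicate≡ones : ∀ i → replicate (2 * i) 1 ≡ ones i
replicate≡ones zero    = refl
replicate≡ones (suc i) rewrite +-suc i (i + 0) = cong (λ xs → 1 ∷ 1 ∷ xs) (replicate≡ones i)

Reads : (ℕ → ℕ) → ℕ → List ℕ → Set
Reads c s []       = ⊤
Reads c s (x ∷ xs) = c s ≡ x × Reads c (suc s) xs

num-upper≥1 : ∀ K → 1 ≤ num upper (suc K)
num-upper≥1 K = ≤-trans (den≥1 upper K ≤-refl) (m≤n+m _ _)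

-- Base case for comparing runs: [0; 2, ...] = a / (2a + b) ≤ 1/2 ≤ [0; 1^{2(K+1)}].
two-upper : ∀ K a b → den upper (suc K) * a ≤ num upper (suc K) * (2 * a + b)
two-upper K a b = begin
  den upper (suc K) * a             ≤⟨ *-monoˡ-≤ a (half≤upper K) ⟩
  2 * num upper (suc K) * a         ≤⟨ m≤m+n _ (num upper (suc K) * b) ⟩
  2 * num upper (suc K) * a + num upper (suc K) * b ≡⟨ e (num upper (suc K)) a b ⟩
  num upper (suc K) * (2 * a + b)   ∎
  where e : ∀ n a b → 2 * n * a + n * b ≡ n * (2 * a + b)
        e = solve-∀

two-upper-< : ∀ K a b → 1 ≤ b → den upper (suc K) * a < num upper (suc K) * (2 * a + b)
two-upper-< K a (suc b) _ = <-≤-trans (s≤s (two-upper K a b))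
  (≤-trans (+-monoˡ-≤ _ (num-upper≥1 K)) (≤-reflexive (e (num upper (suc K)) a b)))
  where e : ∀ n a b → n + n * (2 * a + b) ≡ n * (2 * a + suc b)
        e = solve-∀

two-lower : ∀ a b → b ≤ a → 1 * (2 * a + b) ≤ 3 * a
two-lower a b b≤a = subst (_≤ 3 * a) (e a b)
  (+-monoʳ-≤ a (+-monoʳ-≤ a (≤-trans b≤a (≤-reflexive (sym (+-identityʳ a))))))
  where e : ∀ a b → a + (a + b) ≡ 1 * (2 * a + b)
        e = solve-∀

-- Of 2 + x + y for fractions x = (n , d) and y = (n' , d').
denominator numerator : ℕ × ℕ → ℕ × ℕ → ℕ
denominator (n , d) (n' , d') = d * d'
numerator   (n , d) (n' , d') = 2 * (d * d') + (n * d' + d * n')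

-- Convergents, tails and determinants

module Continued (c : ℕ → ℕ) (pos : ∀ n → 1 ≤ c n) where

  p q p⁻ q⁻ : ℕ → ℕ
  p n  = proj₁ (pq c n)
  q n  = proj₁ (proj₂ (pq c n))
  p⁻ n = proj₁ (proj₂ (proj₂ (pq c n)))
  q⁻ n = proj₂ (proj₂ (proj₂ (pq c n)))

  -- A k n / B k n = [c (n+1); …, c (n+k)].
  A B : ℕ → ℕ → ℕ
  A zero    n = 1
  A (suc k) n = c (suc n) * A k (suc n) + B k (suc n)
  B zero    n = 0
  B (suc k) n = A k (suc n)

  A≥1 : ∀ k n → 1 ≤ A k n
  A≥1 zero    n = ≤-refl
  A≥1 (suc k) n = ≤-trans (*-mono-≤ (pos (suc n)) (A≥1 k (suc n))) (m≤m+n _ _)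

  B≤A : ∀ k n → B k n ≤ A k n
  B≤A zero    n = z≤n
  B≤A (suc k) n = ≤-trans (≤-trans (≤-reflexive (sym (*-identityˡ _)))
    (*-monoˡ-≤ (A k (suc n)) (pos (suc n)))) (m≤m+n _ _)

  q≥1 : ∀ n → 1 ≤ q n
  q≥1 zero    = ≤-refl
  q≥1 (suc n) = ≤-trans (*-mono-≤ (pos (suc n)) (q≥1 n)) (m≤m+n _ _)

  q-step : ∀ n → q n ≤ q (suc n)
  q-step n = ≤-trans (≤-trans (≤-reflexive (sym (*-identityˡ _)))
    (*-monoˡ-≤ (q n) (pos (suc n)))) (m≤m+n _ _)

  q⁻≤q : ∀ n → q⁻ n ≤ q n
  q⁻≤q zero    = z≤n
  q⁻≤q (suc n) = q-step n

  q-mono : ∀ {m n} → m ≤ n → q m ≤ q n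
  q-mono {m} {n} m≤n = subst (λ z → q m ≤ q z) (m∸n+n≡m m≤n) (go (n ∸ m))
    where
    go : ∀ k → q m ≤ q (k + m)
    go zero    = ≤-refl
    go (suc k) = ≤-trans (go k) (q-step (k + m))

  n≤q : ∀ n → n ≤ q n
  n≤q zero          = z≤n
  n≤q (suc zero)    = q≥1 1
  n≤q (suc (suc n)) = begin
    suc (suc n)                       ≡⟨ +-comm 1 (suc n) ⟩
    suc n + 1                         ≤⟨ +-mono-≤ (n≤q (suc n)) (q≥1 n) ⟩
    q (suc n) + q n                   ≤⟨ +-monoˡ-≤ (q n) (≤-trans (≤-reflexive (sym (*-identityˡ _)))
                                           (*-monoˡ-≤ (q (suc n)) (pos (suc (suc n))))) ⟩
    q (suc (suc n))                   ∎

  -- The first k entries after index n act on (v_n, v_{n-1}), where v_n = (p_n, q_n), through the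
  -- tail A/B alone.
  p-split : ∀ k n → p (k + n) ≡ A k n * p n + B k n * p⁻ n
  p-split zero    n = sym (trans (+-identityʳ _) (*-identityˡ (p n)))
  p-split (suc k) n = trans (cong p (sym (+-suc k n))) (trans (p-split k (suc n))
    (e (A k (suc n)) (B k (suc n)) (c (suc n)) (p n) (p⁻ n)))
    where e : ∀ a b c x y → a * (c * x + y) + b * x ≡ (c * a + b) * x + a * y
          e = solve-∀

  q-split : ∀ k n → q (k + n) ≡ A k n * q n + B k n * q⁻ n
  q-split zero    n = sym (trans (+-identityʳ _) (*-identityˡ (q n)))
  q-split (suc k) n = trans (cong q (sym (+-suc k n))) (trans (q-split k (suc n))
    (e (A k (suc n)) (B k (suc n)) (c (suc n)) (q n) (q⁻ n)))
    where e : ∀ a b c x y → a * (c * x + y) + b * x ≡ (c * a + b) * x + a * y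
          e = solve-∀

  -- The determinant ±1 of consecutive convergents, written without subtraction: one equation for
  -- each sign.
  DetEven DetOdd : ℕ → Set
  DetEven n = p⁻ n * q n ≡ p n * q⁻ n + 1
  DetOdd  n = p n * q⁻ n ≡ p⁻ n * q n + 1

  det-suc-even : ∀ n → DetEven n → DetOdd (suc n)
  det-suc-even n h = trans (e₁ (c (suc n)) (p n) (p⁻ n) (q n)) (trans (cong (λ z → c (suc n) * (p n * q n) + z) h)
    (e₂ (c (suc n)) (p n) (q n) (q⁻ n)))
    where
    e₁ : ∀ c p p⁻ q → (c * p + p⁻) * q ≡ c * (p * q) + p⁻ * q
    e₁ = solve-∀
    e₂ : ∀ c p q q⁻ → c * (p * q) + (p * q⁻ + 1) ≡ p * (c * q + q⁻) + 1
    e₂ = solve-∀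

  det-suc-odd : ∀ n → DetOdd n → DetEven (suc n)
  det-suc-odd n h = trans (e₁ (c (suc n)) (p n) (q n) (q⁻ n)) (trans (cong (λ z → c (suc n) * (p n * q n) + z) h)
    (e₂ (c (suc n)) (p n) (p⁻ n) (q n)))
    where
    e₁ : ∀ c p q q⁻ → p * (c * q + q⁻) ≡ c * (p * q) + p * q⁻
    e₁ = solve-∀
    e₂ : ∀ c p p⁻ q → c * (p * q) + (p⁻ * q + 1) ≡ (c * p + p⁻) * q + 1
    e₂ = solve-∀

  det-2j : ∀ j → DetEven (2 * j)
  det-2j zero    = sym (cong (_+ 1) (*-zeroʳ (c 0)))
  det-2j (suc j) = subst DetEven (sym (*-suc 2 j))
    (det-suc-odd _ (det-suc-even _ (det-2j j)))

  det-1+2j : ∀ j → DetOdd (suc (2 * j))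
  det-1+2j j = det-suc-even _ (det-2j j)

  det : ∀ n → DetEven n ⊎ DetOdd n
  det zero    = inj₁ (det-2j 0)
  det (suc n) = [ inj₂ ∘ det-suc-even n , inj₁ ∘ det-suc-odd n ]′ (det n)

  private
    -- Multiplicativity of 2×2 determinants, with the negative terms moved across.
    cross : ∀ X Y A B P Q P' Q' →
      (X * P + Y * P') * (A * Q + B * Q') + X * B * (P' * Q) + Y * A * (P * Q')
      ≡ (X * Q + Y * Q') * (A * P + B * P') + X * B * (P * Q') + Y * A * (P' * Q)
    cross = solve-∀

    cross⁺ : ∀ S S' a b u v → u ≡ v + 1 → S + a * u + b * v ≡ S' + a * v + b * u → S + a ≡ S' + b
    cross⁺ S S' a b u v refl h = +-cancelʳ-≡ (a * v + b * v) _ _ (trans (e₁ S a b v) (trans h (e₂ S' a b v)))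
      where
      e₁ : ∀ S a b v → S + a + (a * v + b * v) ≡ S + a * (v + 1) + b * v
      e₁ = solve-∀
      e₂ : ∀ S a b v → S + a * v + b * (v + 1) ≡ S + b + (a * v + b * v)
      e₂ = solve-∀

  -- The determinant of (X v_n + Y v_{n-1}, v_{k+n}), where v_n = (p_n, q_n).
  module _ (k n X Y : ℕ) where

    private
      x y P Q : ℕ
      x = X * p n + Y * p⁻ n
      y = X * q n + Y * q⁻ n
      P = p (k + n)
      Q = q (k + n)

      base : x * Q + X * B k n * (p⁻ n * q n) + Y * A k n * (p n * q⁻ n)
             ≡ y * P + X * B k n * (p n * q⁻ n) + Y * A k n * (p⁻ n * q n)
      base rewrite p-split k n | q-split k n = cross X Y (A k n) (B k n) (p n) (q n) (p⁻ n) (q⁻ n)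

    cross-even : DetEven n → x * Q + X * B k n ≡ y * P + Y * A k n
    cross-even h = cross⁺ _ _ (X * B k n) (Y * A k n) _ _ h base

    cross-odd : DetOdd n → y * P + X * B k n ≡ x * Q + Y * A k n
    cross-odd h = cross⁺ _ _ (X * B k n) (Y * A k n) _ _ h (sym base)

    -- Closeness on both sides means M y |xQ - yP| ≤ D Q, and |xQ - yP| = |YA - XB|. The parity of n
    -- decides which side xQ - yP = ±(YA - XB) concerns, hence which hypothesis is used.
    gap : ∀ {M D} → Above M D x y P Q → Below M D x y P Q →
          M * y * (Y * A k n) ≤ M * y * (X * B k n) + D * Q
    gap {M} {D} (above ab) (below be) with det n
    ... | inj₁ h = +-cancelˡ-≤ (M * y * y * P) _ _ (begin
      M * y * y * P + M * y * (Y * A k n)       ≡⟨ e₁ (M * y) y P (Y * A k n) ⟩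
      M * y * (y * P + Y * A k n)               ≡⟨ cong (M * y *_) (cross-even h) ⟨
      M * y * (x * Q + X * B k n)               ≡⟨ e₁ (M * y) x Q (X * B k n) ⟨
      M * y * x * Q + M * y * (X * B k n)       ≤⟨ +-monoˡ-≤ _ ab ⟩
      M * y * y * P + D * Q + M * y * (X * B k n) ≡⟨ e₂ (M * y * y * P) (D * Q) _ ⟩
      M * y * y * P + (M * y * (X * B k n) + D * Q) ∎)
      where
      e₁ : ∀ m a b z → m * a * b + m * z ≡ m * (a * b + z)
      e₁ = solve-∀
      e₂ : ∀ a b c → a + b + c ≡ a + (c + b)
      e₂ = solve-∀
    ... | inj₂ h = +-cancelˡ-≤ (M * y * x * Q) _ _ (begin
      M * y * x * Q + M * y * (Y * A k n)       ≡⟨ e₁ (M * y) x Q (Y * A k n) ⟩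
      M * y * (x * Q + Y * A k n)               ≡⟨ cong (M * y *_) (cross-odd h) ⟨
      M * y * (y * P + X * B k n)               ≡⟨ e₁ (M * y) y P (X * B k n) ⟨
      M * y * y * P + M * y * (X * B k n)       ≤⟨ +-monoˡ-≤ _ be ⟩
      M * y * x * Q + D * Q + M * y * (X * B k n) ≡⟨ e₂ (M * y * x * Q) (D * Q) _ ⟩
      M * y * x * Q + (M * y * (X * B k n) + D * Q) ∎)
      where
      e₁ : ∀ m a b z → m * a * b + m * z ≡ m * (a * b + z)
      e₁ = solve-∀
      e₂ : ∀ a b c → a + b + c ≡ a + (c + b)
      e₂ = solve-∀

  -- Bounds on tails and reversed initial segments

  -- Pairs of ones are peeled off both sides until [0; 2, ...] < 1/2 decides. The bound on k keeps
  -- an entry after the 2 in the truncated tail, which makes the inequality strict.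
  right-upper : ∀ {i K k n xs} → i < K → length (ones K) ≤ k →
                Reads c (suc n) (ones i ++ 2 ∷ xs) →
                den upper K * B k n < num upper K * A k n
  right-upper {zero} {suc K} {suc (suc k)} {n} _ _ (r , _) rewrite r =
    two-upper-< K (A (suc k) (suc n)) (A k (suc (suc n))) (A≥1 k _)
  right-upper {suc i} {suc K} {suc (suc k)} {n} (s≤s i<K) (s≤s (s≤s h)) (r₁ , r₂ , r)
    rewrite r₁ | r₂ = mobius-< (num upper K) (den upper K) (A k (suc (suc n))) (B k (suc (suc n)))
      (right-upper {i} {K} {k} i<K h r)
  right-upper {zero} {suc K} {suc zero} _ (s≤s ()) _

  right-lower : ∀ {K k n xs} → length (ones K) < k → Reads c (suc n) (ones K ++ 2 ∷ xs) →
                num lower K * A k n ≤ den lower K * B k n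
  right-lower {zero} {suc k} {n} _ (r , _) rewrite r = two-lower _ _ (B≤A k (suc n))
  right-lower {suc K} {suc (suc k)} {n} (s≤s (s≤s h)) (r₁ , r₂ , r)
    rewrite r₁ | r₂ = mobius-≥ (num lower K) (den lower K) (A k (suc (suc n))) (B k (suc (suc n)))
      (right-lower {K} {k} h r)

  private
    shift₂ : ∀ j m → length (ones j) + suc (suc m) ≡ length (ones (suc j)) + m
    shift₂ j m = trans (+-suc _ _) (cong suc (+-suc _ _))

  -- As q_{m-1} / q_m = [0; c m, ..., c 1], reading two more ones of `c` prepends them to this
  -- fraction. The induction therefore runs forward, and i grows with each pair read.
  left-upper-ones : ∀ j m i → Reads c (suc m) (ones j) →
    den upper i * q⁻ m ≤ num upper i * q m →
    den upper (j + i) * q⁻ (length (ones j) + m) ≤ num upper (j + i) * q (length (ones j) + m)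
  left-upper-ones zero    m i _ h = h
  left-upper-ones (suc j) m i (r₁ , r₂ , r) h =
    subst₂ (λ K M → den upper K * q⁻ M ≤ num upper K * q M) (+-suc j i) (shift₂ j m)
      (left-upper-ones j (suc (suc m)) (suc i) r step)
    where
    step : den upper (suc i) * q⁻ (suc (suc m)) ≤ num upper (suc i) * q (suc (suc m))
    step rewrite r₁ | r₂ = mobius-≤ (num upper i) (den upper i) (q m) (q⁻ m) h

  left-lower-ones : ∀ j m i → Reads c (suc m) (ones j) →
    num lower i * q m ≤ den lower i * q⁻ m →
    num lower (j + i) * q (length (ones j) + m) ≤ den lower (j + i) * q⁻ (length (ones j) + m)
  left-lower-ones zero    m i _ h = h
  left-lower-ones (suc j) m i (r₁ , r₂ , r) h =
    subst₂ (λ K M → num lower K * q M ≤ den lower K * q⁻ M) (+-suc j i) (shift₂ j m)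
      (left-lower-ones j (suc (suc m)) (suc i) r step)
    where
    step : num lower (suc i) * q (suc (suc m)) ≤ den lower (suc i) * q⁻ (suc (suc m))
    step rewrite r₁ | r₂ = mobius-≥ (num lower i) (den lower i) (q m) (q⁻ m) h

  left-upper : ∀ {j K n} → j < K → Reads c (suc n) (2 ∷ ones j) →
    den upper K * q⁻ (length (ones j) + suc n) ≤ num upper K * q (length (ones j) + suc n)
  left-upper {j} {K} {n} j<K (r , rs) with m≤n⇒∃[o]m+o≡n j<K
  -- `o` is K - j - 1: the comparison starts at the 2 with o + 1 pairs, and the j pairs that follow
  -- bring it to K.
  ... | o , refl =
    subst (λ K → den upper K * q⁻ (length (ones j) + suc n) ≤ num upper K * q (length (ones j) + suc n))
    (+-suc j o) (left-upper-ones j (suc n) (suc o) rs seed)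
    where
    seed : den upper (suc o) * q n ≤ num upper (suc o) * q (suc n)
    seed rewrite r = two-upper o (q n) (q⁻ n)

  left-lower : ∀ {j n} → Reads c (suc n) (2 ∷ ones j) →
    num lower j * q (length (ones j) + suc n) ≤ den lower j * q⁻ (length (ones j) + suc n)
  left-lower {j} {n} (r , rs) =
    subst (λ K → num lower K * q (length (ones j) + suc n) ≤ den lower K * q⁻ (length (ones j) + suc n))
    (+-identityʳ j) (left-lower-ones j (suc n) 0 rs seed)
    where
    seed : 1 * q (suc n) ≤ 3 * q n
    seed rewrite r = two-lower _ _ (q⁻≤q n)

  -- The central 2 has index m + 1, just after the convergent of order m. The 2 on the left has an
  -- index `suc n`, never 0, because [0; c m, ..., c 1] omits `c 0`.
  Surrounded : ℕ → ℕ → ℕ → Set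
  Surrounded m i j =
    (∃ λ xs → Reads c (suc m) (2 ∷ ones i ++ 2 ∷ xs)) ×
    (∃ λ n → m ≡ length (ones j) + suc n × Reads c (suc n) (2 ∷ ones j))

  -- With N = k + 1 + m, `q-split` gives q_N / (q_m B) = A/B + q_{m-1}/q_m, that is, 2 plus the tail
  -- fraction plus the reversed segment. Each of the two fractions has just been bounded.
  surrounded-upper : ∀ {m i j K L k} → Surrounded m i j → i < K → j < L → length (ones K) ≤ k →
    denominator (frac upper K) (frac upper L) * q (suc k + m)
      < numerator (frac upper K) (frac upper L) * q m * B (suc k) m
  surrounded-upper {m} {i} {j} {K} {L} {k} ((xs , r , rs) , n , refl , ls) i<K j<L h
    rewrite q-split (suc k) m | r = begin-strict
    dK * dL * ((2 * a + b) * Q + a * Q⁻)                             ≡⟨ e₁ dK dL a b Q Q⁻ ⟩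
    2 * (dK * dL) * Q * a + dL * Q * (dK * b) + dK * a * (dL * Q⁻)   <⟨ +-mono-<-≤ (+-monoʳ-< _ right) left ⟩
    2 * (dK * dL) * Q * a + dL * Q * (nK * a) + dK * a * (nL * Q)    ≡⟨ e₂ nK dK nL dL a Q ⟩
    (2 * (dK * dL) + (nK * dL + dK * nL)) * Q * a                    ∎
    where
    nK = num upper K
    dK = den upper K
    nL = num upper L
    dL = den upper L
    a = A k (suc m)
    b = B k (suc m)
    Q = q m
    Q⁻ = q⁻ m
    left : dK * a * (dL * Q⁻) ≤ dK * a * (nL * Q)
    left = *-monoʳ-≤ (dK * a) (left-upper {j} {L} j<L ls)
    right : dL * Q * (dK * b) < dL * Q * (nK * a)
    right = *-monoʳ-< (dL * Q) ⦃ >-nonZero (*-mono-≤ (den≥1 upper L ≤-refl) (q≥1 m)) ⦄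
      (right-upper {i} {K} {k} i<K h rs)
    e₁ : ∀ dK dL a b Q Q⁻ → dK * dL * ((2 * a + b) * Q + a * Q⁻)
                          ≡ 2 * (dK * dL) * Q * a + dL * Q * (dK * b) + dK * a * (dL * Q⁻)
    e₁ = solve-∀
    e₂ : ∀ nK dK nL dL a Q → 2 * (dK * dL) * Q * a + dL * Q * (nK * a) + dK * a * (nL * Q)
                           ≡ (2 * (dK * dL) + (nK * dL + dK * nL)) * Q * a
    e₂ = solve-∀

  surrounded-lower : ∀ {m K L k} → Surrounded m K L → length (ones K) < k →
    numerator (frac lower K) (frac lower L) * q m * B (suc k) m
      ≤ denominator (frac lower K) (frac lower L) * q (suc k + m)
  surrounded-lower {m} {K} {L} {k} ((xs , r , rs) , n , refl , ls) h
    rewrite q-split (suc k) m | r = begin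
    (2 * (dK * dL) + (nK * dL + dK * nL)) * Q * a                    ≡⟨ e₂ nK dK nL dL a Q ⟩
    2 * (dK * dL) * Q * a + dL * Q * (nK * a) + dK * a * (nL * Q)    ≤⟨ +-mono-≤ (+-monoʳ-≤ _ right) left ⟩
    2 * (dK * dL) * Q * a + dL * Q * (dK * b) + dK * a * (dL * Q⁻)   ≡⟨ e₁ dK dL a b Q Q⁻ ⟩
    dK * dL * ((2 * a + b) * Q + a * Q⁻)                             ∎
    where
    nK = num lower K
    dK = den lower K
    nL = num lower L
    dL = den lower L
    a = A k (suc m)
    b = B k (suc m)
    Q = q m
    Q⁻ = q⁻ m
    left : dK * a * (nL * Q) ≤ dK * a * (dL * Q⁻)
    left = *-monoʳ-≤ (dK * a) (left-lower {L} ls)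
    right : dL * Q * (nK * a) ≤ dL * Q * (dK * b)
    right = *-monoʳ-≤ (dL * Q) (right-lower {K} {k} h rs)
    e₁ : ∀ dK dL a b Q Q⁻ → 2 * (dK * dL) * Q * a + dL * Q * (dK * b) + dK * a * (dL * Q⁻)
                          ≡ dK * dL * ((2 * a + b) * Q + a * Q⁻)
    e₁ = solve-∀
    e₂ : ∀ nK dK nL dL a Q → (2 * (dK * dL) + (nK * dL + dK * nL)) * Q * a
                           ≡ 2 * (dK * dL) * Q * a + dL * Q * (nK * a) + dK * a * (nL * Q)
    e₂ = solve-∀

  -- The sum is 1 + b/a + q_{m-1}/q_m < 3 ≤ M/D. The condition 2 ≤ k makes b < a strict.
  one-upper : ∀ {M D m k} → 1 ≤ D → 3 * D ≤ M → 2 ≤ k → c (suc m) ≡ 1 →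
              D * q (suc k + m) < M * q m * B (suc k) m
  one-upper {k = suc zero} _ _ (s≤s ())
  one-upper {M} {D} {m} {suc (suc k)} D≥1 3D≤M _ r
    rewrite q-split (suc (suc (suc k))) m | r = begin-strict
    D * ((1 * a + b) * Q + a * Q⁻)      <⟨ *-monoʳ-< D ⦃ >-nonZero D≥1 ⦄ (+-mono-<-≤
                                             (*-monoˡ-< Q ⦃ >-nonZero (q≥1 m) ⦄ (+-monoʳ-< (1 * a) b<a))
                                             (*-monoʳ-≤ a (q⁻≤q m))) ⟩
    D * ((1 * a + a) * Q + a * Q)       ≡⟨ e D a Q ⟩
    3 * D * (Q * a)                     ≤⟨ *-monoˡ-≤ (Q * a) 3D≤M ⟩
    M * (Q * a)                         ≡⟨ *-assoc M Q a ⟨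
    M * Q * a                           ∎
    where
    a = A (suc (suc k)) (suc m)
    b = B (suc (suc k)) (suc m)
    Q = q m
    Q⁻ = q⁻ m
    e : ∀ D a Q → D * ((1 * a + a) * Q + a * Q) ≡ 3 * D * (Q * a)
    e = solve-∀
    b<a : b < a
    b<a = begin-strict
      b                                ≡⟨ *-identityˡ b ⟨
      1 * b                            ≤⟨ *-monoˡ-≤ b (pos (suc (suc m))) ⟩
      c (suc (suc m)) * b              <⟨ m<m+n _ (A≥1 k _) ⟩
      a                                ∎

  -- Locating a fraction among the convergents

  -- (x , y) has nonnegative coordinates in the basis (v_n , v_{n-1}), where v_n = (p_n , q_n),
  -- but no longer in (v_{n+1} , v_n).
  Floor : ℕ → ℕ → Set
  Floor x y = Σ ℕ λ n → Σ ℕ λ X → Σ ℕ λ Y →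
    x ≡ X * p n + Y * p⁻ n × y ≡ X * q n + Y * q⁻ n × X < c (suc n) * Y

  -- A Euclidean algorithm: if X = c (n+1) · Y + Z, then X v_n + Y v_{n-1} = Y v_{n+1} + Z v_n. The
  -- sum of the coefficients falls, so it serves as fuel.
  descend : ∀ fuel {x y} n X Y → 1 ≤ X → X + Y ≤ fuel →
            x ≡ X * p n + Y * p⁻ n → y ≡ X * q n + Y * q⁻ n → Floor x y
  -- A multiple of v_n is recorded at index n + 1 with first coefficient 0; `not-admissible`
  -- recognises convergents by this form.
  descend _ n X zero X≥1 _ ex ey =
    suc n , 0 , X , trans ex (+-identityʳ _) , trans ey (+-identityʳ _) , *-mono-≤ (pos (suc (suc n))) X≥1
  descend zero n (suc X) (suc Y) _ ()
  descend (suc fuel) n X (suc Y) X≥1 h ex ey with X <? c (suc n) * suc Y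
  ... | yes lt = n , X , suc Y , ex , ey , lt
  ... | no  ge with m≤n⇒∃[o]m+o≡n (≮⇒≥ ge)
  ...   | Z , refl = descend fuel (suc n) (suc Y) Z (s≤s z≤n) bound
                       (trans ex (e (c (suc n)) (suc Y) Z (p n) (p⁻ n)))
                       (trans ey (e (c (suc n)) (suc Y) Z (q n) (q⁻ n)))
    where
    e : ∀ c Y Z x x⁻ → (c * Y + Z) * x + Y * x⁻ ≡ Y * (c * x + x⁻) + Z * x
    e = solve-∀
    bound : suc Y + Z ≤ fuel
    bound = s≤s⁻¹ (begin-strict
      suc Y + Z                          ≡⟨ cong (_+ Z) (*-identityˡ (suc Y)) ⟨
      1 * suc Y + Z                      ≤⟨ +-monoˡ-≤ Z (*-monoˡ-≤ (suc Y) (pos (suc n))) ⟩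
      c (suc n) * suc Y + Z              <⟨ m<m+n _ (s≤s z≤n) ⟩
      c (suc n) * suc Y + Z + suc Y      ≤⟨ h ⟩
      suc fuel                           ∎)

  floor : ∀ x y → 1 ≤ y → c 0 * y ≤ x → Floor x y
  floor x y y≥1 h with m≤n⇒∃[o]m+o≡n h
  ... | Z , refl = descend (y + Z) 0 y Z y≥1 ≤-refl (e₁ (c 0) y Z) (e₂ y Z)
    where
    e₁ : ∀ c y Z → c * y + Z ≡ y * c + Z * 1
    e₁ = solve-∀
    e₂ : ∀ y Z → y ≡ y * 1 + Z * 0
    e₂ = solve-∀

  -- From inequalities between convergents to admissibility

  even≤ : ∀ j {N} → 2 * j ≤ N → p (2 * j) * q N ≤ q (2 * j) * p N
  even≤ j {N} h = subst (λ N → p (2 * j) * q N ≤ q (2 * j) * p N) (m∸n+n≡m h)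
    (subst₂ _≤_ (e (p (2 * j)) (p⁻ (2 * j)) _) (trans (+-identityʳ _) (e (q (2 * j)) (q⁻ (2 * j)) _))
      (≤-trans (m≤m+n _ (1 * B k (2 * j))) (≤-reflexive (cross-even k (2 * j) 1 0 (det-2j j)))))
    where
    k = N ∸ 2 * j
    e : ∀ x y z → (1 * x + 0 * y) * z ≡ x * z
    e = solve-∀

  odd≥ : ∀ j {N} → suc (2 * j) ≤ N → q (suc (2 * j)) * p N ≤ p (suc (2 * j)) * q N
  odd≥ j {N} h = subst (λ N → q (suc (2 * j)) * p N ≤ p (suc (2 * j)) * q N) (m∸n+n≡m h)
    (subst₂ _≤_ (e (q (suc (2 * j))) (q⁻ (suc (2 * j))) _)
      (trans (+-identityʳ _) (e (p (suc (2 * j))) (p⁻ (suc (2 * j))) _))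
      (≤-trans (m≤m+n _ (1 * B k (suc (2 * j)))) (≤-reflexive (cross-odd k (suc (2 * j)) 1 0 (det-1+2j j)))))
    where
    k = N ∸ suc (2 * j)
    e : ∀ x y z → (1 * x + 0 * y) * z ≡ x * z
    e = solve-∀

  private
    suc-pred-q : ∀ N → suc (pred (q N)) ≡ q N
    suc-pred-q N = suc-pred (q N) ⦃ >-nonZero (q≥1 N) ⦄

  conv-above⇒ : ∀ m d x y' N → mkℚᵘ (+ x) y' - invLq² m d (suc y') ≤ᵠ conv c N →
                Above (suc m) (suc d) x (suc y') (p N) (q N)
  conv-above⇒ m d x y' N h = subst (Above (suc m) (suc d) x (suc y') (p N)) (suc-pred-q N)
    (above⇒ m d x y' (p N) (pred (q N)) h)

  conv-above⇐ : ∀ m d x y' N → Above (suc m) (suc d) x (suc y') (p N) (q N) →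
                mkℚᵘ (+ x) y' - invLq² m d (suc y') ≤ᵠ conv c N
  conv-above⇐ m d x y' N h = above⇐ m d x y' (p N) (pred (q N))
    (subst (Above (suc m) (suc d) x (suc y') (p N)) (sym (suc-pred-q N)) h)

  conv-below⇒ : ∀ m d x y' N → conv c N ≤ᵠ mkℚᵘ (+ x) y' +ᵠ invLq² m d (suc y') →
                Below (suc m) (suc d) x (suc y') (p N) (q N)
  conv-below⇒ m d x y' N h = subst (Below (suc m) (suc d) x (suc y') (p N)) (suc-pred-q N)
    (below⇒ m d x y' (p N) (pred (q N)) h)

  conv-below⇐ : ∀ m d x y' N → Below (suc m) (suc d) x (suc y') (p N) (q N) →
                conv c N ≤ᵠ mkℚᵘ (+ x) y' +ᵠ invLq² m d (suc y')
  conv-below⇐ m d x y' N h = below⇐ m d x y' (p N) (pred (q N))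
    (subst (Below (suc m) (suc d) x (suc y') (p N)) (sym (suc-pred-q N)) h)

  conv-below-neg⇒ : ∀ m d x y' N → conv c N ≤ᵠ mkℚᵘ -[1+ x ] y' +ᵠ invLq² m d (suc y') →
                Below (suc m) (suc d) 0 (suc y') (p N) (q N)
  conv-below-neg⇒ m d x y' N h = subst (Below (suc m) (suc d) 0 (suc y') (p N)) (suc-pred-q N)
    (below-neg⇒ m d x y' (p N) (pred (q N)) h)

  c₀q≤p : ∀ N → c 0 * q N ≤ p N
  c₀q≤p N = subst (λ N → c 0 * q N ≤ p N) (+-identityʳ N) (begin
    c 0 * q (N + 0)                       ≡⟨ cong (c 0 *_) (q-split N 0) ⟩
    c 0 * (A N 0 * 1 + B N 0 * 0)         ≡⟨ e (c 0) (A N 0) (B N 0) ⟩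
    A N 0 * c 0                           ≤⟨ m≤m+n _ _ ⟩
    A N 0 * c 0 + B N 0 * 1               ≡⟨ p-split N 0 ⟨
    p (N + 0)                             ∎)
    where e : ∀ c a b → c * (a * 1 + b * 0) ≡ a * c
          e = solve-∀

  -- Every convergent is at least `c 0`, so x/y falls short of it by at least 1/y, which exceeds D /
  -- (M y²).
  below-floor : ∀ {M D x y N} → D < M → x < c 0 * y → ¬ Below M D x y (p N) (q N)
  below-floor {M} {D} {x} {y@(suc _)} {N} D<M x< (below h) = <⇒≱ lt (+-cancelˡ-≤ (M * y * x * q N) _ _ (begin
    M * y * x * q N + M * y * q N    ≡⟨ e₁ (M * y) x (q N) ⟩
    M * y * (suc x * q N)            ≤⟨ *-monoʳ-≤ (M * y) (*-monoˡ-≤ (q N) x<) ⟩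
    M * y * (c 0 * y * q N)          ≡⟨ e₂ (M * y) (c 0) y (q N) ⟩
    M * y * y * (c 0 * q N)          ≤⟨ *-monoʳ-≤ (M * y * y) (c₀q≤p N) ⟩
    M * y * y * p N                  ≤⟨ h ⟩
    M * y * x * q N + D * q N        ∎))
    where
    e₁ : ∀ m x q → m * x * q + m * q ≡ m * (suc x * q)
    e₁ = solve-∀
    e₂ : ∀ m c y q → m * (c * y * q) ≡ m * y * (c * q)
    e₂ = solve-∀
    lt : D * q N < M * y * q N
    lt = *-monoˡ-< (q N) ⦃ >-nonZero (q≥1 N) ⦄ (<-≤-trans D<M (m≤m*n M y))
  below-floor {x = x} {zero} D<M x< _ = n≮0 (subst (x <_) (*-zeroʳ (c 0)) x<)

  -- A non-convergent x/y strictly between two consecutive convergents is never close: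
  -- y |y α − x| ≥ 1/3, so Legendre's theorem is not needed.
  between : ∀ {M D k n X Y} → 1 ≤ D → 3 * D ≤ M → c (suc n) ≤ 2 → 1 ≤ X → X < c (suc n) * Y →
    ¬ (M * (X * q n + Y * q⁻ n) * (Y * A (suc k) n)
        ≤ M * (X * q n + Y * q⁻ n) * (X * B (suc k) n) + D * q (suc k + n))
  between {M} {D} {k} {n} {X} {zero} _ _ _ _ X< _ = n≮0 (subst (X <_) (*-zeroʳ (c (suc n))) X<)
  between {M} {D} {k} {n} {X} {Y@(suc _)} D≥1 3D≤M c≤2 X≥1 X< h =
    -- X < c (n+1) · Y gives Y A - X B ≥ a + b, while y ≥ Q + Q⁻. Together with 3D ≤ M this forces 3
    -- (Q + Q⁻)(a + b) ≤ q_{k+1+n}, which is too large.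
    <⇒≱ small (*-cancelˡ-≤ D ⦃ >-nonZero D≥1 ⦄ (begin
      D * (3 * (Q + Q⁻) * (a + b))             ≡⟨ e₃ D (Q + Q⁻) (a + b) ⟩
      3 * D * (Q + Q⁻) * (a + b)               ≤⟨ *-monoˡ-≤ (a + b) (*-mono-≤ 3D≤M y≥) ⟩
      M * y * (a + b)                          ≤⟨ +-cancelˡ-≤ (M * y * (X * a)) _ _ gap' ⟩
      D * q (suc k + n)                        ≤⟨ *-monoʳ-≤ D q≤ ⟩
      D * ((2 * a + b) * Q + a * Q⁻)           ∎))
    where
    a = A k (suc n)
    b = B k (suc n)
    Q = q n
    Q⁻ = q⁻ n
    y = X * Q + Y * Q⁻
    e₁ : ∀ m X a b → m * (X * a) + m * (a + b) ≡ m * (suc X * a + 1 * b)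
    e₁ = solve-∀
    e₂ : ∀ c Y a b → c * Y * a + Y * b ≡ Y * (c * a + b)
    e₂ = solve-∀
    e₃ : ∀ D q s → D * (3 * q * s) ≡ 3 * D * q * s
    e₃ = solve-∀
    e₄ : ∀ a b q q⁻ → (2 * a + b) * q + a * q⁻ + (q * a + (2 * q * b + 2 * q⁻ * a + 3 * q⁻ * b))
                    ≡ 3 * (q + q⁻) * (a + b)
    e₄ = solve-∀
    y≥ : Q + Q⁻ ≤ y
    y≥ = +-mono-≤ (≤-trans (≤-reflexive (sym (*-identityˡ Q))) (*-monoˡ-≤ Q X≥1)) (m≤m+n Q⁻ _)
    q≤ : q (suc k + n) ≤ (2 * a + b) * Q + a * Q⁻
    q≤ = ≤-trans (≤-reflexive (q-split (suc k) n))
      (+-monoˡ-≤ (a * Q⁻) (*-monoˡ-≤ Q (+-monoˡ-≤ b (*-monoˡ-≤ a c≤2))))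
    gap' : M * y * (X * a) + M * y * (a + b) ≤ M * y * (X * a) + D * q (suc k + n)
    gap' = begin
      M * y * (X * a) + M * y * (a + b)        ≡⟨ e₁ (M * y) X a b ⟩
      M * y * (suc X * a + 1 * b)              ≤⟨ *-monoʳ-≤ (M * y) (+-mono-≤ (*-monoˡ-≤ a X<)
                                                   (*-monoˡ-≤ b {1} {Y} (s≤s z≤n))) ⟩
      M * y * (c (suc n) * Y * a + Y * b)      ≡⟨ cong (M * y *_) (e₂ (c (suc n)) Y a b) ⟩
      M * y * (Y * A (suc k) n)                ≤⟨ h ⟩
      M * y * (X * a) + D * q (suc k + n)      ∎
    small : (2 * a + b) * Q + a * Q⁻ < 3 * (Q + Q⁻) * (a + b)
    small = <-≤-trans (m<m+n _ (≤-trans (*-mono-≤ (q≥1 n) (A≥1 k (suc n))) (m≤m+n _ _)))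
      (≤-reflexive (e₄ a b Q Q⁻))

  -- A close fraction would be negative, below `c 0`, strictly between convergents, or a convergent.
  -- The last case contradicts the hypothesis on n and k, since a denominator above `q T` forces
  -- order at least T.
  not-admissible : ∀ {m d} T S → 3 * suc d ≤ suc m → (∀ n → c n ≤ 2) →
    (∀ n k → T ≤ n → S ≤ k → suc d * q (suc k + n) < suc m * q n * B (suc k) n) →
    ¬ Admissible c m d
  not-admissible {m} {d} T S 3D≤M c≤2 core adm with adm (q T)
  ... | -[1+ x ] , y' , _ , _ , _ , (j , be) = below-floor {M = suc m} {N = suc (2 * j)}
    (<-≤-trans (m<m+n (suc d) (s≤s z≤n)) 3D≤M) (*-mono-≤ (pos 0) (s≤s {n = y'} z≤n))
    (conv-below-neg⇒ m d x y' (suc (2 * j)) be)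
  ... | + x , y' , big , cop , (i , ab) , (j , be) with x <? c 0 * suc y'
  ...   | yes x< = below-floor {M = suc m} {N = suc (2 * j)}
    (<-≤-trans (m<m+n (suc d) (s≤s z≤n)) 3D≤M) x< (conv-below⇒ m d x y' (suc (2 * j)) be)
  ...   | no  x≥ with floor x (suc y') (s≤s z≤n) (≮⇒≥ x≥)
  ...     | n , X , Y , ex , ey , X< = finish n X Y ex ey X<
    where
    M = suc m
    D = suc d
    y = suc y'
    -- Reaches past both convergents that witness the cut and leaves at least S entries.
    k = 2 * i + suc (2 * j) + S
    aboveAt : ∀ N → 2 * i ≤ N → Above M D x y (p N) (q N)
    aboveAt N h = above-mono {M} {D} {x} {y} (q≥1 (2 * i)) (even≤ i h) (conv-above⇒ m d x y' (2 * i) ab)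
    belowAt : ∀ N → suc (2 * j) ≤ N → Below M D x y (p N) (q N)
    belowAt N h = below-mono {M} {D} {x} {y} (q≥1 (suc (2 * j))) (odd≥ j h) (conv-below⇒ m d x y' (suc (2 * j)) be)
    gapAt : ∀ n X Y → x ≡ X * p n + Y * p⁻ n → y ≡ X * q n + Y * q⁻ n →
            M * y * (Y * A (suc k) n) ≤ M * y * (X * B (suc k) n) + D * q (suc k + n)
    gapAt n X Y ex ey =
      subst (λ y → M * y * (Y * A (suc k) n) ≤ M * y * (X * B (suc k) n) + D * q (suc k + n)) (sym ey)
      (gap (suc k) n X Y (subst₂ (λ x y → Above M D x y (p (suc k + n)) (q (suc k + n))) ex ey (aboveAt _ i≤))
                         (subst₂ (λ x y → Below M D x y (p (suc k + n)) (q (suc k + n))) ex ey (belowAt _ j≤)))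
      where
      i≤ : 2 * i ≤ suc k + n
      i≤ = m≤n⇒m≤n+o n (m≤n⇒m≤1+n (m≤n⇒m≤n+o S (m≤m+n (2 * i) _)))
      j≤ : suc (2 * j) ≤ suc k + n
      j≤ = m≤n⇒m≤n+o n (m≤n⇒m≤1+n (m≤n⇒m≤n+o S (m≤n+m _ (2 * i))))
    finish : ∀ n X Y → x ≡ X * p n + Y * p⁻ n → y ≡ X * q n + Y * q⁻ n → X < c (suc n) * Y → ⊥
    finish n (suc X) Y ex ey X< = between {M} {D} {k} {n} {suc X} {Y} (s≤s z≤n) 3D≤M (c≤2 _) (s≤s z≤n) X<
      (subst (λ y → M * y * (Y * A (suc k) n) ≤ M * y * (suc X * B (suc k) n) + D * q (suc k + n)) ey
        (gapAt n (suc X) Y ex ey))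
    finish zero    zero Y ex ey X< = 1+n≢0 (trans ey (*-zeroʳ Y))
    -- Here x/y is the convergent of order n, seen from index n + 1; `A (suc k) (suc n)` is
    -- `B (suc (suc k)) n` by definition.
    finish (suc n) zero Y ex ey X< = <⇒≱ (core n (suc k) T≤n (m≤n⇒m≤1+n (m≤n+m S _))) (begin
      M * q n * A (suc k) (suc n)             ≡⟨ cong₂ (λ y z → M * y * z) (sym y≡q) (sym (1*≡ (A (suc k) (suc n)))) ⟩
      M * y * (Y * A (suc k) (suc n))         ≤⟨ gapAt (suc n) 0 Y ex ey ⟩
      M * y * 0 + D * q (suc k + suc n)       ≡⟨ cong₂ (λ u v → u + D * q v) (*-zeroʳ (M * y)) (+-suc (suc k) n) ⟩
      D * q (suc (suc k) + n)                 ∎)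
      where
      Y≡1 : Y ≡ 1
      Y≡1 = cop (subst (Y ∣_) (sym ex) (∣m⇒∣m*n (p n) (divides 1 (sym (+-identityʳ Y)))) ,
                 subst (Y ∣_) (sym ey) (∣m⇒∣m*n (q n) (divides 1 (sym (+-identityʳ Y)))))
      1*≡ : ∀ z → Y * z ≡ z
      1*≡ z = trans (cong (_* z) Y≡1) (*-identityˡ z)
      y≡q : y ≡ q n
      y≡q = trans ey (1*≡ (q n))
      T≤n : T ≤ n
      T≤n = ≮⇒≥ λ n<T → <⇒≱ big (≤-trans (≤-reflexive y≡q) (q-mono (<⇒≤ n<T)))

  coprime-pq : ∀ n → Coprime (p n) (q n)
  coprime-pq n {e} (e∣p , e∣q) with det n
  ... | inj₁ h = ∣1⇒≡1 (∣m+n∣m⇒∣n (subst (e ∣_) h (∣n⇒∣m*n (p⁻ n) e∣q)) (∣m⇒∣m*n (q⁻ n) e∣p))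
  ... | inj₂ h = ∣1⇒≡1 (∣m+n∣m⇒∣n (subst (e ∣_) h (∣m⇒∣m*n (q⁻ n) e∣p)) (∣n⇒∣m*n (p⁻ n) e∣q))

  module _ (k n : ℕ) where
    private
      e : ∀ x y z → (1 * x + 0 * y) * z ≡ x * z
      e = solve-∀
      e⁺ : ∀ x y z w → (1 * x + 0 * y) * z + 1 * w ≡ x * z + w
      e⁺ = solve-∀

    -- The absolute difference is exactly `B k n`. The parity of n tells which of the two
    -- inequalities is an equality.
    conv-distance : p n * q (k + n) ≤ q n * p (k + n) + B k n × q n * p (k + n) ≤ p n * q (k + n) + B k n
    conv-distance with det n
    ... | inj₁ h = ≤-trans (m≤m+n _ (B k n)) (≤-trans (≤-reflexive eq) (m≤m+n _ _)) , ≤-reflexive (sym eq)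
      where
      eq : p n * q (k + n) + B k n ≡ q n * p (k + n)
      eq = trans (sym (e⁺ (p n) (p⁻ n) _ _)) (trans (cross-even k n 1 0 h) (trans (+-identityʳ _) (e (q n) (q⁻ n) _)))
    ... | inj₂ h = ≤-reflexive (sym eq) , ≤-trans (m≤m+n _ (B k n)) (≤-trans (≤-reflexive eq) (m≤m+n _ _))
      where
      eq : q n * p (k + n) + B k n ≡ p n * q (k + n)
      eq = trans (sym (e⁺ (q n) (q⁻ n) _ _)) (trans (cross-odd k n 1 0 h) (trans (+-identityʳ _) (e (p n) (p⁻ n) _)))

  private
    distance⇒ : ∀ m x Q y P B E → x * Q ≤ y * P + B → m * B ≤ E → m * x * Q ≤ m * y * P + E
    distance⇒ m x Q y P B E h₁ h₂ = begin
      m * x * Q             ≡⟨ *-assoc m x Q ⟩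
      m * (x * Q)           ≤⟨ *-monoʳ-≤ m h₁ ⟩
      m * (y * P + B)       ≡⟨ e m y P B ⟩
      m * y * P + m * B     ≤⟨ +-monoʳ-≤ _ h₂ ⟩
      m * y * P + E         ∎
      where e : ∀ m y P B → m * (y * P + B) ≡ m * y * P + m * B
            e = solve-∀

  admissible : ∀ {m d} S →
    (∀ N → Σ ℕ λ n → N ≤ n × (∀ k → S ≤ k → suc m * q n * B (suc k) n ≤ suc d * q (suc k + n))) →
    Admissible c m d
  -- N + 1 is requested because n ≤ q_n is only a weak inequality.
  admissible {m} {d} S often N with often (suc N)
  ... | n , N<n , bound = + p n , pred (q n) , subst (N <_) (sym q≡) (≤-trans N<n (n≤q n)) ,
    subst (Coprime (p n)) (sym q≡) (coprime-pq n) ,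
    (suc (n + S) , conv-above⇐ m d (p n) (pred (q n)) N₁
      (subst₂ (λ y N → Above (suc m) (suc d) (p n) y (p N) (q N)) (sym q≡) (sym eq₁)
        (aboveAt (n + 2 * S + 1) (m≤n⇒m≤n+o 1 S≤)))) ,
    (suc (n + S) , conv-below⇐ m d (p n) (pred (q n)) (suc N₁)
      (subst₂ (λ y N → Below (suc m) (suc d) (p n) y (p N) (q N)) (sym q≡) (sym eq₂)
        (belowAt (n + 2 * S + 2) (m≤n⇒m≤n+o 2 S≤))))
    where
    q≡ : suc (pred (q n)) ≡ q n
    q≡ = suc-pred (q n) ⦃ >-nonZero (q≥1 n) ⦄
    -- An even order and its odd successor, one for each half of the cut; both have the form k + 1 +
    -- n with k ≥ S.
    N₁ = 2 * suc (n + S)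
    eq₁ : N₁ ≡ suc (n + 2 * S + 1) + n
    eq₁ = e n S
      where e : ∀ n S → 2 * suc (n + S) ≡ suc (n + 2 * S + 1) + n
            e = solve-∀
    eq₂ : suc N₁ ≡ suc (n + 2 * S + 2) + n
    eq₂ = e n S
      where e : ∀ n S → suc (2 * suc (n + S)) ≡ suc (n + 2 * S + 2) + n
            e = solve-∀
    S≤ : S ≤ n + 2 * S
    S≤ = ≤-trans (m≤m+n S _) (m≤n+m (2 * S) n)
    aboveAt : ∀ k → S ≤ k → Above (suc m) (suc d) (p n) (q n) (p (suc k + n)) (q (suc k + n))
    aboveAt k h = above $ distance⇒ (suc m * q n) (p n) _ (q n) _ _ _ (proj₁ (conv-distance (suc k) n)) (bound k h)
    belowAt : ∀ k → S ≤ k → Below (suc m) (suc d) (p n) (q n) (p (suc k + n)) (q (suc k + n))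
    belowAt k h = below $ distance⇒ (suc m * q n) (q n) _ (p n) _ _ _ (proj₂ (conv-distance (suc k) n)) (bound k h)

-- Block structure and types of the period

-- Records that all runs of ones between twos have even length.
data Blocks : List ℕ → Set where
  []  : Blocks []
  2∷_ : ∀ {xs} → Blocks xs → Blocks (2 ∷ xs)
  11∷_ : ∀ {xs} → Blocks xs → Blocks (1 ∷ 1 ∷ xs)

blocks-++ : ∀ {xs ys} → Blocks xs → Blocks ys → Blocks (xs ++ ys)
blocks-++ []        bs' = bs'
blocks-++ (2∷ bs)  bs' = 2∷ (blocks-++ bs bs')
blocks-++ (11∷ bs) bs' = 11∷ (blocks-++ bs bs')

-- A 2 is always a block of its own, so cutting at it breaks no pair of ones.
blocks-split : ∀ xs {ys} → Blocks (xs ++ 2 ∷ ys) → Blocks xs × Blocks ys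
blocks-split []           (2∷ bs)  = [] , bs
blocks-split (_ ∷ [])     (2∷ bs)  = map₁ 2∷_ (blocks-split [] bs)
blocks-split (_ ∷ x ∷ xs) (2∷ bs)  = map₁ 2∷_ (blocks-split (x ∷ xs) bs)
blocks-split (_ ∷ _ ∷ xs) (11∷ bs) = map₁ 11∷_ (blocks-split xs bs)

blocks-f : ∀ w → Blocks (f w)
blocks-f []          = []
blocks-f (_ ∷ [])    = []
blocks-f (R ∷ R ∷ w) = 11∷ (blocks-f (R ∷ w))
blocks-f (R ∷ U ∷ w) = 2∷ (blocks-f (U ∷ w))
blocks-f (U ∷ R ∷ w) = 2∷ (blocks-f (R ∷ w))
blocks-f (U ∷ U ∷ w) = 11∷ (blocks-f (U ∷ w))

-- A word with both letters changes letter somewhere. This supplies a 2 besides the leading one of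
-- the period.
2∈f : ∀ w → 1 ≤ countR w → 1 ≤ countU w → 2 ∈ f w
2∈f []          ()
2∈f (R ∷ [])    _ ()
2∈f (U ∷ [])    ()
2∈f (R ∷ R ∷ w) r u = there (there (2∈f (R ∷ w) (s≤s z≤n) u))
2∈f (R ∷ U ∷ w) r u = here refl
2∈f (U ∷ R ∷ w) r u = here refl
2∈f (U ∷ U ∷ w) r u = there (there (2∈f (U ∷ w) r (s≤s z≤n)))

blocks-nth : ∀ {xs n} → Blocks xs → n < length xs → nthOr0 xs n ≡ 1 ⊎ nthOr0 xs n ≡ 2
blocks-nth {n = zero}        (2∷ bs)  _ = inj₂ refl
blocks-nth {n = suc n}       (2∷ bs)  (s≤s h) = blocks-nth bs h
blocks-nth {n = zero}        (11∷ bs) _ = inj₁ refl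
blocks-nth {n = suc zero}    (11∷ bs) _ = inj₁ refl
blocks-nth {n = suc (suc n)} (11∷ bs) (s≤s (s≤s h)) = blocks-nth bs h

first-two : ∀ {xs} → Blocks xs → 2 ∈ xs → ∃ λ i → ∃ λ ys → xs ≡ ones i ++ 2 ∷ ys × Blocks ys
first-two (2∷ bs)  _ = 0 , _ , refl , bs
first-two (11∷ bs) (there (there h)) with first-two bs h
... | i , ys , refl , bs' = suc i , ys , refl , bs'

last-two : ∀ {xs} → Blocks xs → (∃ λ j → xs ≡ ones j) ⊎ (∃ λ zs → ∃ λ j → xs ≡ zs ++ 2 ∷ ones j)
last-two []        = inj₁ (0 , refl)
last-two (2∷ bs)  with last-two bs
... | inj₁ (j , refl)      = inj₂ ([] , j , refl)
... | inj₂ (zs , j , refl) = inj₂ (2 ∷ zs , j , refl)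
last-two (11∷ bs) with last-two bs
... | inj₁ (j , refl)      = inj₁ (suc j , refl)
... | inj₂ (zs , j , refl) = inj₂ (1 ∷ 1 ∷ zs , j , refl)

-- `HasType` for a single rotation, without its leading 2 and with both indices lowered by one.
Typed : ℕ → ℕ → List ℕ → Set
Typed i j xs = ∃ λ Y → FirstLast2 Y × xs ≡ ones i ++ Y ++ ones j

blocks-typed : ∀ {xs} → Blocks xs → 2 ∈ xs → ∃ λ i → ∃ λ j → Typed i j xs
blocks-typed bs h with first-two bs h
... | i , ys , refl , bs' with last-two bs'
...   | inj₁ (j , refl)      = i , j , 2 ∷ [] , inj₁ refl , refl
...   | inj₂ (zs , j , refl) = i , j , 2 ∷ (zs ++ 2 ∷ []) , inj₂ (zs , refl) ,
  cong (λ u → ones i ++ 2 ∷ u) (sym (++-assoc zs (2 ∷ []) (ones j)))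

typed-prefix : ∀ {i j xs} → Typed i j xs → ∃ λ ys → xs ≡ ones i ++ 2 ∷ ys
typed-prefix (_ , inj₁ refl       , eq) = _ , eq
typed-prefix (_ , inj₂ (_ , refl) , eq) = _ , eq

typed-suffix : ∀ {i j xs} → Typed i j xs → ∃ λ zs → xs ≡ zs ++ 2 ∷ ones j
typed-suffix {i} (_ , inj₁ refl       , eq) = ones i , eq
typed-suffix {i} {j} (_ , inj₂ (Z , refl) , eq) = ones i ++ 2 ∷ Z , trans eq
  (trans (cong (λ u → ones i ++ 2 ∷ u) (++-assoc Z (2 ∷ []) (ones j)))
    (sym (++-assoc (ones i) (2 ∷ Z) (2 ∷ ones j))))

-- Reading rotations along a periodic sequence

module _ {c : ℕ → ℕ} where

  reads-++⁺ : ∀ xs {ys s} → Reads c s xs → Reads c (length xs + s) ys → Reads c s (xs ++ ys)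
  reads-++⁺ []       _       h = h
  reads-++⁺ (x ∷ xs) {ys} {s} (r , rs) h =
    r , reads-++⁺ xs rs (subst (λ s → Reads c s ys) (sym (+-suc (length xs) s)) h)

  reads-++⁻ˡ : ∀ xs {ys s} → Reads c s (xs ++ ys) → Reads c s xs
  reads-++⁻ˡ []       _        = tt
  reads-++⁻ˡ (x ∷ xs) (r , rs) = r , reads-++⁻ˡ xs rs

  reads-++⁻ʳ : ∀ xs {ys s} → Reads c s (xs ++ ys) → Reads c (length xs + s) ys
  reads-++⁻ʳ []       h        = h
  reads-++⁻ʳ (x ∷ xs) {ys} {s} (_ , rs) = subst (λ s → Reads c s ys) (+-suc (length xs) s) (reads-++⁻ʳ xs rs)

  reads-shift : ∀ {T} → (∀ n → c (T + n) ≡ c n) → ∀ xs {s} → Reads c s xs → Reads c (T + s) xs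
  reads-shift per []       _ = tt
  reads-shift {T} per (x ∷ xs) {s} (r , rs) =
    trans (per s) r , subst (λ s → Reads c s xs) (+-suc T s) (reads-shift per xs rs)

  reads-nth : ∀ xs s → (∀ n → n < length xs → c (s + n) ≡ nthOr0 xs n) → Reads c s xs
  reads-nth []       s h = tt
  reads-nth (x ∷ xs) s h = subst (λ s → c s ≡ x) (+-identityʳ s) (h 0 (s≤s z≤n)) ,
    reads-nth xs (suc s) λ n n< → subst (λ s → c s ≡ nthOr0 xs n) (+-suc s n) (h (suc n) (s≤s n<))

  -- The part `take k P` is read one period later, right after `drop k P`.
  reads-rotate : ∀ P → (∀ n → c (length P + n) ≡ c n) → Reads c 0 P → ∀ k → k ≤ length P → Reads c k (rotate k P)
  reads-rotate P per r k k≤ = reads-++⁺ (drop k P)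
    (subst (λ s → Reads c s (drop k P)) start≡ (reads-++⁻ʳ (take k P) r'))
    (subst (λ s → Reads c s (take k P)) end≡ (reads-shift per (take k P) (reads-++⁻ˡ (take k P) r')))
    where
    r' : Reads c 0 (take k P ++ drop k P)
    r' = subst (Reads c 0) (sym (take++drop≡id k P)) r
    start≡ : length (take k P) + 0 ≡ k
    start≡ = trans (+-identityʳ _) (trans (length-take k P) (m≤n⇒m⊓n≡m k≤))
    end≡ : length P + 0 ≡ length (drop k P) + k
    end≡ = trans (+-identityʳ _) (trans (sym (m∸n+n≡m k≤)) (cong (_+ k) (sym (length-drop k P))))

length-rotate : ∀ k (P : List ℕ) → length (rotate k P) ≡ length P
length-rotate k P = trans (length-++ (drop k P)) (trans (+-comm (length (drop k P)) _)
  (trans (sym (length-++ (take k P))) (cong length (take++drop≡id k P))))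

typed⇒HasType : ∀ {i j k P xs} → k < length P → rotate k P ≡ 2 ∷ xs → Typed i j xs → HasType (suc i) (suc j) P
typed⇒HasType {i} {j} {k} k< eq (Y , fl , refl) = k , k< , Y , fl ,
  trans eq (sym (cong₂ (λ u v → 2 ∷ u ++ Y ++ v) (replicate≡ones i) (replicate≡ones j)))

HasType⇒typed : ∀ {i j P} → HasType (suc i) (suc j) P → ∃ λ k → k < length P ×
  ∃ λ xs → rotate k P ≡ 2 ∷ xs × Typed i j xs
HasType⇒typed {i} {j} (k , k< , Y , fl , eq) = k , k< , _ , eq , Y , fl ,
  cong₂ (λ u v → u ++ Y ++ v) (replicate≡ones i) (replicate≡ones j)

module Periodic (w : Word) where

  P : List ℕ
  P = period w

  T : ℕ
  T = length P

  c : ℕ → ℕ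
  c = gseq w

  blocks-P : Blocks P
  blocks-P = 2∷ (blocks-f w)

  one-or-two : ∀ n → c n ≡ 1 ⊎ c n ≡ 2
  one-or-two n = blocks-nth blocks-P (m%n<n n T)

  pos : ∀ n → 1 ≤ c n
  pos n with c n | one-or-two n
  ... | _ | inj₁ refl = s≤s z≤n
  ... | _ | inj₂ refl = s≤s z≤n

  c≤2 : ∀ n → c n ≤ 2
  c≤2 n with c n | one-or-two n
  ... | _ | inj₁ refl = s≤s z≤n
  ... | _ | inj₂ refl = ≤-refl

  periodic : ∀ n → c (T + n) ≡ c n
  periodic n = cong (nthOr0 P) (trans (cong (_% T) (+-comm T n)) ([m+n]%n≡m%n n T))

  reads-P : Reads c 0 P
  reads-P = reads-nth P 0 λ n n< → cong (nthOr0 P) (m<n⇒m%n≡m n<)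

  open Continued c pos public

  reads-at : ∀ {k} → k < T → ∀ t → Reads c (t * T + k) (rotate k P)
  reads-at {k} k< zero    = reads-rotate P periodic reads-P k (<⇒≤ k<)
  reads-at {k} k< (suc t) = subst (λ s → Reads c s (rotate k P)) (sym (+-assoc T (t * T) k))
    (reads-shift periodic (rotate k P) (reads-at k< t))

  -- The rotation is read twice: the copy starting at m + 1 gives the right side, and the copy one
  -- period earlier ends with the left side.
  typed⇒surrounded : ∀ {i j k xs m} t → k < T → rotate k P ≡ 2 ∷ xs → Typed i j xs →
                     suc m ≡ suc t * T + k → Surrounded m i j
  typed⇒surrounded {i} {j} {k} {xs} {m} t k< eq ty m≡ with typed-prefix {i} {j} ty | typed-suffix {i} {j} ty
  ... | ys , pre | zs , suf =
    (ys , subst₂ (Reads c) (sym m≡) (trans eq (cong (2 ∷_) pre)) (reads-at k< (suc t))) ,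
    length zs + (t * T + k) ,
    suc-injective (trans m≡ (trans (cong (λ T → T + t * length P + k) T≡)
      (e (length zs) (length (ones j)) (t * T) k))) ,
    reads-++⁻ʳ (2 ∷ zs) (subst (Reads c (t * T + k)) (trans eq (cong (2 ∷_) suf)) (reads-at k< t))
    where
    T≡ : T ≡ suc (length zs) + suc (length (ones j))
    T≡ = trans (sym (length-rotate k P)) (trans (cong length (trans eq (cong (2 ∷_) suf))) (cong suc (length-++ zs)))
    e : ∀ z o t k → suc z + suc o + t + k ≡ suc (o + suc (z + (t + k)))
    e = solve-∀

  module _ (2∈ : 2 ∈ f w) where

    typed-at : ∀ {k} → k < T → c k ≡ 2 → ∃ λ xs → rotate k P ≡ 2 ∷ xs × ∃ λ i → ∃ λ j → Typed i j xs
    typed-at {k} k< ck with drop k P in dr | reads-rotate P periodic reads-P k (<⇒≤ k<)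
    ... | [] | _ = ⊥-elim (m>n⇒m∸n≢0 k< (trans (sym (length-drop k P)) (cong length dr)))
    ... | x ∷ Z | r , _ with trans (sym r) ck
    ... | refl = Z ++ take k P , refl , blocks-typed (blocks-++ (proj₂ bs) (proj₁ bs)) (has-two k dr)
      where
      bs : Blocks (take k P) × Blocks Z
      bs = blocks-split (take k P) (subst Blocks (trans (sym (take++drop≡id k P)) (cong (take k P ++_) dr)) blocks-P)
      -- For k = 0 the second 2 comes from `f w`; otherwise the leading 2 of the period has moved
      -- into `take k P`.
      has-two : ∀ k → drop k P ≡ 2 ∷ Z → 2 ∈ Z ++ take k P
      has-two zero    refl = ∈-++⁺ˡ 2∈
      has-two (suc k) _    = ∈-++⁺ʳ Z (here refl)

    surrounded-at : ∀ {m} → T ≤ m → c (suc m) ≡ 2 →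
      ∃ λ i → ∃ λ j → HasType (suc i) (suc j) P × Surrounded m i j
    surrounded-at {m} T≤m cm =
      -- At least one full period precedes index m + 1, which leaves room for the left side.
      go (suc m / T) (m≥n⇒m/n>0 {suc m} {T} (m≤n⇒m≤1+n T≤m)) (m≡m%n+[m/n]*n (suc m) T)
      where
      k = suc m % T
      k< : k < T
      k< = m%n<n (suc m) T
      ck : c k ≡ 2
      ck = trans (cong (nthOr0 P) (m%n%n≡m%n (suc m) T)) cm
      go : ∀ t → 0 < t → suc m ≡ k + t * T → ∃ λ i → ∃ λ j → HasType (suc i) (suc j) P × Surrounded m i j
      go (suc t) _ m≡ with typed-at k< ck
      ... | xs , eq , i , j , ty = i , j , typed⇒HasType {i} {j} k< eq ty ,
        typed⇒surrounded {i} {j} t k< eq ty (trans m≡ (+-comm k _))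

  surrounded-often : ∀ {i j} → HasType (suc i) (suc j) P → ∀ N → Σ ℕ λ m → N ≤ m × Surrounded m i j
  surrounded-often {i} {j} h N with HasType⇒typed {i} {j} h
  ... | k , k< , xs , eq , ty = pred (suc N * T + k) , N≤ , typed⇒surrounded {i} {j} N k< eq ty refl
    where
    N≤ : N ≤ pred (suc N * T + k)
    N≤ = s≤s⁻¹ (≤-trans (m≤m*n (suc N) T) (m≤m+n (suc N * T) k))

-- Comparison of the two thresholds and conclusion

numerator-comm : ∀ x y → numerator x y ≡ numerator y x
numerator-comm (n , d) (n' , d') = e n d n' d'
  where e : ∀ n d n' d' → 2 * (d * d') + (n * d' + d * n') ≡ 2 * (d' * d) + (n' * d + d' * n)
        e = solve-∀

numerator-< : ∀ K L → numerator (frac upper K) (frac upper L) * denominator (frac lower K) (frac lower L)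
                    < numerator (frac lower K) (frac lower L) * denominator (frac upper K) (frac upper L)
numerator-< K L = subst₂ _<_ (sym (e n d n' d' N D N' D')) (sym (e' n d n' d' N D N' D'))
  (+-monoʳ-< (2 * (d * d') * (D * D')) (+-mono-<-≤
    (*-monoˡ-< (d' * D') ⦃ >-nonZero (*-mono-≤ (den≥1 upper L ≤-refl) (den≥1 lower L (s≤s z≤n))) ⦄ (frac-< K))
    (*-monoˡ-≤ (d * D) (<⇒≤ (frac-< L)))))
  where
  n = num upper K
  d = den upper K
  n' = num upper L
  d' = den upper L
  N = num lower K
  D = den lower K
  N' = num lower L
  D' = den lower L
  e : ∀ n d n' d' N D N' D' → (2 * (d * d') + (n * d' + d * n')) * (D * D')
      ≡ 2 * (d * d') * (D * D') + (n * D * (d' * D') + n' * D' * (d * D))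
  e = solve-∀
  e' : ∀ n d n' d' N D N' D' → (2 * (D * D') + (N * D' + D * N')) * (d * d')
      ≡ 2 * (d * d') * (D * D') + (N * d * (d' * D') + N' * d' * (d * D))
  e' = solve-∀

denominator≥1 : ∀ x K L → 1 ≤ proj₂ x → 1 ≤ denominator (frac x K) (frac x L)
denominator≥1 x K L h = *-mono-≤ (den≥1 x K h) (den≥1 x L h)

numerator≥1 : ∀ x K L → 1 ≤ proj₂ x → 1 ≤ numerator (frac x K) (frac x L)
numerator≥1 x K L h = ≤-trans (denominator≥1 x K L h) (≤-trans (m≤m+n _ _) (m≤m+n _ _))

-- Both fractions added to 2 are at least 1/2 by `half≤upper`.
3≤threshold : ∀ {K L} → 1 ≤ K → 1 ≤ L →
  3 * denominator (frac upper K) (frac upper L) ≤ numerator (frac upper K) (frac upper L)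
3≤threshold {suc K} {suc L} _ _ = subst (_≤ numerator (frac upper (suc K)) (frac upper (suc L))) (e (d * d'))
  (+-monoʳ-≤ (2 * (d * d')) (*-cancelˡ-≤ 2 (subst₂ _≤_ (e₁ d d') (e₂ n d n' d')
    (+-mono-≤ (*-monoˡ-≤ d' (half≤upper K)) (*-monoʳ-≤ d (half≤upper L))))))
  where
  n = num upper (suc K)
  d = den upper (suc K)
  n' = num upper (suc L)
  d' = den upper (suc L)
  e : ∀ x → 2 * x + x ≡ 3 * x
  e = solve-∀
  e₁ : ∀ d d' → d * d' + d * d' ≡ 2 * (d * d')
  e₁ = solve-∀
  e₂ : ∀ n d n' d' → 2 * n * d' + d * (2 * n') ≡ 2 * (n * d' + d * n')
  e₂ = solve-∀

-- The thresholds are not syntactically successors, so the admissibility claims carry equations for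
-- m and d instead.
lagrange-lt : ∀ {w w' M D M' D'} → 1 ≤ M → 1 ≤ D → 1 ≤ M' → 1 ≤ D' → M * D' < M' * D →
  (∀ {m d} → suc m ≡ M → suc d ≡ D → ¬ Admissible (gseq w) m d) →
  (∀ {m d} → suc m ≡ M' → suc d ≡ D' → Admissible (gseq w') m d) →
  LagrangeLt w w'
lagrange-lt {M = suc m} {suc d} {suc m'} {suc d'} _ _ _ _ lt ¬adm adm =
  m , d , m' , d' , *<* (subst₂ ℤ._<_ (ℤ.pos-* (suc m) (suc d')) (ℤ.pos-* (suc m') (suc d)) (ℤ.+<+ lt)) ,
  ¬adm refl refl , adm refl refl

theorem4p2 : (a b : ℕ) → 1 ≤ b → b < a → Coprime a b →
    (ω ω' : Word) → InD a b ω → InD a b ω' →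
    (k l : ℕ) → 1 ≤ k → 1 ≤ l → HasType k l (period ω') →
    (∀ i j → 1 ≤ i → 1 ≤ j → HasType i j (period ω) →
    (i < k × j < l) ⊎ (i < l × j < k)) →
    LagrangeLt ω ω'
theorem4p2 a b b≥1 b<a _ ω ω' (#R , #U , _) _ (suc K) (suc L) _ _ type' smaller =
  lagrange-lt {ω} {ω'} (numerator≥1 upper K L ≤-refl) D≥1 (numerator≥1 lower K L (s≤s z≤n))
    (denominator≥1 lower K L (s≤s z≤n)) (numerator-< K L) ¬adm adm
  where
  module W  = Periodic ω
  module W' = Periodic ω'

  2∈ : 2 ∈ f ω
  2∈ = 2∈f ω (subst (1 ≤_) (sym #R) (≤-trans b≥1 (<⇒≤ b<a))) (subst (1 ≤_) (sym #U) b≥1)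

  smaller' : ∀ i j → HasType (suc i) (suc j) (period ω) → (i < K × j < L) ⊎ (i < L × j < K)
  smaller' i j h = [ inj₁ ∘ map s≤s⁻¹ s≤s⁻¹ , inj₂ ∘ map s≤s⁻¹ s≤s⁻¹ ]′
    (smaller (suc i) (suc j) (s≤s z≤n) (s≤s z≤n) h)

  K,L≥1 : 1 ≤ K × 1 ≤ L
  -- The unrotated period begins with 2 and so has a type (i + 1, j + 1); i and j lie below K and L
  -- in some order, so both are positive.
  K,L≥1 with W.typed-at 2∈ {0} (s≤s z≤n) refl
  ... | _ , eq , i , j , ty = [ map m<n⇒0<n m<n⇒0<n , swap ∘ map m<n⇒0<n m<n⇒0<n ]′
    (smaller' i j (typed⇒HasType {i} {j} (s≤s z≤n) eq ty))

  M = numerator (frac upper K) (frac upper L)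
  D = denominator (frac upper K) (frac upper L)
  D≥1 : 1 ≤ D
  D≥1 = denominator≥1 upper K L ≤-refl
  -- Long enough for the tail estimate with K and L in either order, and for 2 ≤ k in `one-upper`.
  S = length (ones K) + length (ones L) + 2

  3D≤M : 3 * D ≤ M
  3D≤M = 3≤threshold (proj₁ K,L≥1) (proj₂ K,L≥1)

  core : ∀ n k → W.T ≤ n → S ≤ k → D * W.q (suc k + n) < M * W.q n * W.B (suc k) n
  core n k T≤n S≤k with W.one-or-two (suc n)
  ... | inj₁ one = W.one-upper D≥1 3D≤M (≤-trans (m≤n+m 2 _) S≤k) one
  ... | inj₂ two with W.surrounded-at 2∈ T≤n two
  ...   | i , j , ty , sur with smaller' i j ty
  ...     | inj₁ (i<K , j<L) = W.surrounded-upper {i = i} {j} sur i<K j<L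
    (≤-trans (m≤n⇒m≤n+o 2 (m≤m+n (length (ones K)) _)) S≤k)
  -- The threshold r is symmetric in K and L.
  ...     | inj₂ (i<L , j<K) = subst₂ (λ D M → D * W.q (suc k + n) < M * W.q n * W.B (suc k) n)
    (*-comm (den upper L) (den upper K)) (numerator-comm (frac upper L) (frac upper K))
    (W.surrounded-upper {i = i} {j} sur i<L j<K (≤-trans (m≤n⇒m≤n+o 2 (m≤n+m (length (ones L)) _)) S≤k))

  M' = numerator (frac lower K) (frac lower L)
  D' = denominator (frac lower K) (frac lower L)

  ¬adm : ∀ {m d} → suc m ≡ M → suc d ≡ D → ¬ Admissible (gseq ω) m d
  ¬adm {m} {d} eM eD = W.not-admissible {m} {d} W.T S
    (subst₂ (λ D M → 3 * D ≤ M) (sym eD) (sym eM) 3D≤M) W.c≤2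
    (subst₂ (λ D M → ∀ n k → W.T ≤ n → S ≤ k → D * W.q (suc k + n) < M * W.q n * W.B (suc k) n)
      (sym eD) (sym eM) core)

  adm : ∀ {m d} → suc m ≡ M' → suc d ≡ D' → Admissible (gseq ω') m d
  -- 2K + 1 entries keep the 2 after the run of ones inside the truncated tail.
  adm {m} {d} eM eD = W'.admissible {m} {d} (suc (length (ones K))) λ N →
    let n , N≤n , sur = W'.surrounded-often {K} {L} type' N in
    n , N≤n , λ k S≤k →
      subst₂ (λ D M → M * W'.q n * W'.B (suc k) n ≤ D * W'.q (suc k + n)) (sym eD) (sym eM)
        (W'.surrounded-lower {n} {K} {L} sur S≤k)
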